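{- Let $t \ge 1$ and $n_1,\ldots,n_t$ be positive integers such that the direct product $K_{n_1}\times K_{n_2}\times\cdots\times K_{n_t}$ is connected. Then the domination polynomial of $K_{n_1}\times\cdots\times K_{n_t}$ is unimodal.
   Context: For a finite simple graph $G$, a set $U \subseteq V(G)$ is dominating if every vertex is in $U$ or adjacent to a vertex of $U$; $d_i(G)$ is the number of dominating sets of size $i$ and $D(G,x)=\sum_{i} d_i(G)x^i$ is the domination polynomial. A polynomial is unimodal if its coefficients (ordered by increasing power of $x$) are non-decreasing and then non-increasing. $K_n$ denotes the complete graph on $n$ vertices. The direct product $G\times H$ of graphs $G,H$ has vertex set $V(G)\times V(H)$, with $(g,h)$ adjacent to $(g',h')$ iff $\{g,g'\}\in E(G)$ and $\{h,h'\}\in E(H)$; products of several graphs are defined associatively. -}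

module Defs where

open import Data.Nat using (ℕ; zero; suc; _≤_; _<_)
import Data.Nat as ℕ
open import Data.Fin using (Fin)
import Data.Fin as Fin
open import Data.List using (List; []; _∷_; length; filter; map; concatMap; _++_)
open import Data.List.Relation.Unary.All using (All; []; _∷_)
import Data.List.Relation.Unary.All as All
open import Data.List.Relation.Unary.Any using (Any)
import Data.List.Relation.Unary.Any as Any
open import Data.List.Relation.Unary.Unique.Propositional using (Unique)
import Data.List.Relation.Unary.AllPairs as AllPairs
open import Data.List.Membership.Propositional using (_∈_)
open import Data.Product using (Σ; ∃; _×_; _,_; proj₁; proj₂)
open import Data.Product.Properties using (≡-dec)
open import Data.Sum using (_⊎_; inj₁; inj₂)
open import Data.Unit using (⊤; tt)
open import Data.Empty using (⊥)
open import Data.List using (cartesianProduct; allFin)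
import Data.List.Relation.Unary.Unique.Propositional.Properties as UP
import Data.List.Membership.Propositional.Properties as MP
import Data.Fin.Properties as FinP
open import Relation.Nullary.Decidable using (¬?)
open import Relation.Nullary using (¬_; Dec; yes; no)
open import Relation.Nullary.Decidable using (_×-dec_; _⊎-dec_)
open import Relation.Binary.PropositionalEquality using (_≡_; refl)
import Relation.Binary.PropositionalEquality
open import Relation.Binary.Construct.Closure.ReflexiveTransitive using (Star)
open import Relation.Binary using (DecidableEquality)

record FinGraph : Set₁ where
  field
    V        : Set
    _≟V_     : DecidableEquality V
    vertices : List V
    unique   : Unique vertices
    complete : ∀ v → v ∈ vertices
    Adj      : V → V → Set
    adj?     : ∀ u v → Dec (Adj u v)
    sym      : ∀ {u v} → Adj u v → Adj v u
    irrefl   : ∀ {v} → ¬ Adj v v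

module _ (G : FinGraph) where
  open FinGraph G

  Connected : Set
  Connected = ∀ u v → Star Adj u v

  -- a set of vertices, represented by a (duplicate-free) list U, is
  -- dominating if every vertex is in U or adjacent to a vertex of U
  Dominating : List V → Set
  Dominating U = ∀ v → v ∈ U ⊎ Any (λ u → Adj u v) U

  dominating? : ∀ U → Dec (Dominating U)
  dominating? U with All.all? (λ v → Any.any? (v ≟V_) U ⊎-dec Any.any? (λ u → adj? u v) U) vertices
  ... | yes p = yes (λ v → All.lookup p (complete v))
  ... | no ¬p = no (λ d → ¬p (All.tabulate (λ {v} _ → d v)))

-- all sublists of a list (each subset of a duplicate-free list exactly once)
sublists : ∀ {A : Set} → List A → List (List A)
sublists []       = [] ∷ []
sublists (x ∷ xs) = let r = sublists xs in r ++ map (x ∷_) r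

module _ (G : FinGraph) where
  open FinGraph G

  dom : ℕ → ℕ
  dom i = length (filter (λ U → (length U ℕ.≟ i) ×-dec dominating? G U) (sublists vertices))

-- A coefficient sequence (a : ℕ → ℕ, coefficient of x^i is a i; finitely
-- supported for polynomials) is unimodal: non-decreasing up to some
-- index m and non-increasing from m on.
Unimodal : (ℕ → ℕ) → Set
Unimodal a = Σ ℕ λ m → (∀ i j → i ≤ j → j ≤ m → a i ≤ a j)
                      × (∀ i j → m ≤ i → i ≤ j → a j ≤ a i)

DomPolyUnimodal : FinGraph → Set
DomPolyUnimodal G = Unimodal (dom G)

Tuple : List ℕ → Set
Tuple []       = ⊤
Tuple (n ∷ ns) = Fin n × Tuple ns

-- (g,h) ~ (g',h') iff g ~ g' in K_n (i.e. g ≠ g') and h ~ h'.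
-- For the empty product (not used, t ≥ 1) this is the empty relation.
AdjK : ∀ ns → Tuple ns → Tuple ns → Set
AdjK []            _        _        = ⊥
AdjK (n ∷ [])      (x , _)  (y , _)  = ¬ x ≡ y
AdjK (n ∷ m ∷ ns)  (x , xs) (y , ys) = ¬ x ≡ y × AdjK (m ∷ ns) xs ys

_≟T_ : ∀ {ns} → DecidableEquality (Tuple ns)
_≟T_ {[]}     tt tt = yes refl
_≟T_ {n ∷ ns} = ≡-dec FinP._≟_ _≟T_

allTuples : ∀ ns → List (Tuple ns)
allTuples []       = tt ∷ []
allTuples (n ∷ ns) = cartesianProduct (allFin n) (allTuples ns)

allTuples-unique : ∀ ns → Unique (allTuples ns)
allTuples-unique []       = [] AllPairs.∷ AllPairs.[]
allTuples-unique (n ∷ ns) = UP.cartesianProduct⁺ (UP.allFin⁺ n) (allTuples-unique ns)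

allTuples-complete : ∀ ns (v : Tuple ns) → v ∈ allTuples ns
allTuples-complete []       tt       = Any.here refl
allTuples-complete (n ∷ ns) (x , xs) =
  MP.∈-cartesianProduct⁺ (MP.∈-allFin x) (allTuples-complete ns xs)

adjK? : ∀ ns u v → Dec (AdjK ns u v)
adjK? []           _        _        = no (λ ())
adjK? (n ∷ [])     (x , _)  (y , _)  = ¬? (x FinP.≟ y)
adjK? (n ∷ m ∷ ns) (x , xs) (y , ys) = ¬? (x FinP.≟ y) ×-dec adjK? (m ∷ ns) xs ys

adjK-sym : ∀ ns {u v} → AdjK ns u v → AdjK ns v u
adjK-sym []           ()
adjK-sym (n ∷ [])     p       = λ e → p (Relation.Binary.PropositionalEquality.sym e)
adjK-sym (n ∷ m ∷ ns) (p , q) =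
  (λ e → p (Relation.Binary.PropositionalEquality.sym e)) , adjK-sym (m ∷ ns) q

adjK-irrefl : ∀ ns {v} → ¬ AdjK ns v v
adjK-irrefl []           ()
adjK-irrefl (n ∷ [])     p       = p refl
adjK-irrefl (n ∷ m ∷ ns) (p , _) = p refl

KProd : List ℕ → FinGraph
KProd ns = record
  { V        = Tuple ns
  ; _≟V_     = _≟T_
  ; vertices = allTuples ns
  ; unique   = allTuples-unique ns
  ; complete = allTuples-complete ns
  ; Adj      = AdjK ns
  ; adj?     = adjK? ns
  ; sym      = adjK-sym ns
  ; irrefl   = adjK-irrefl ns
  }

{-# OPTIONS --safe #-}

-- Let G have n vertices and minimum degree d, and let a_i count dominating sets of size i.
-- Supersets of dominating sets are dominating, so (n - i) a_i ≤ (i + 1) a_{i+1}; hence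
-- a_i ≤ a_{i+1} while 2i < n. A non-dominating set avoids some closed neighbourhood, so
-- C(n, i) - a_i ≤ n C(n - d - 1, i). If C(n, k+1) + n C(n - d - 1, k) ≤ C(n, k) then
-- C(n, i+1) ≤ a_i, and so a_{i+1} ≤ a_i, for all i ≥ k. With 2k ≤ n + 3 the two ranges
-- leave at most one undecided comparison, and the sequence is unimodal either way.
-- Such a k exists as soon as (n + 2)² ≤ 12 · 2^d.
--
-- A connected product with more than one vertex has all n_i ≥ 2 and at most one n_i = 2
-- (K₂ × K₂ is disconnected). Then n = Π n_i and d = Π (n_i - 1) satisfy (n + 2)² ≤ 12 · 2^d,
-- except for a few small products, where the binomial inequality is evaluated.
module Submission where

open import Defs
open import Data.Nat using (ℕ; zero; suc; pred; _+_; _*_; _∸_; _^_; _≤_; _<_; z≤n; s≤s; _≡ᵇ_; _≤?_)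
open import Data.Nat.Properties
open import Data.Nat.Combinatorics using (_C_; k>n⇒nCk≡0; nCk+nC[k+1]≡[n+1]C[k+1])
open import Data.Nat.ListAction using (sum; product)
open import Data.Nat.ListAction.Properties using (sum-++)
open import Data.Nat.Tactic.RingSolver using (solve-∀)
open import Algebra.Properties.CommutativeSemigroup +-commutativeSemigroup using (interchange)
open import Algebra.Properties.CommutativeSemigroup *-commutativeSemigroup using (x∙yz≈y∙xz; xy∙z≈y∙xz)
open import Data.Bool using (Bool; true; false; not; _∧_)
open import Data.Fin using (Fin; zero; suc)
import Data.Fin.Properties as Fin
open import Data.List using (List; []; _∷_; _++_; length; filter; map; allFin; cartesianProduct)
open import Data.List.Properties using (length-tabulate; map-++; map-∘; map-tabulate)
open import Data.List.Membership.Propositional using (_∈_; find; lose)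
open import Data.List.Relation.Binary.Subset.Propositional using (_⊆_)
open import Data.List.Relation.Binary.Subset.Propositional.Properties using (Any-resp-⊆; ∷⁺ʳ; xs⊆x∷xs)
open import Data.List.Relation.Unary.All using (All; []; _∷_; all?)
open import Data.List.Relation.Unary.All.Properties using (¬All⇒Any¬)
open import Data.List.Relation.Unary.AllPairs using (_∷_)
open import Data.List.Relation.Unary.Any using (Any; here; there)
import Data.List.Relation.Unary.Any as Any
open import Data.List.Relation.Unary.Unique.Propositional using (Unique)
open import Data.Product using (∃; _×_; _,_; proj₁; proj₂)
open import Data.Sum using (_⊎_; inj₁; inj₂; [_,_]′)
import Data.Sum as Sum
open import Data.Unit using (tt)
open import Function using (_∘_; id)
open import Relation.Binary.Construct.Closure.ReflexiveTransitive using (Star; ε; _◅_; gmap)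
open import Relation.Binary.PropositionalEquality using (_≡_; _≢_; refl; sym; trans; cong; cong₂; subst; subst₂; module ≡-Reasoning)
open import Relation.Nullary using (¬_; Dec; yes; no; does; contradiction)
open import Relation.Nullary.Decidable using (_⊎-dec_; ¬?; True; toWitness; decidable-stable)

private
  variable
    A B : Set

-- Sums over lists

∑ : (A → ℕ) → List A → ℕ
∑ f xs = sum (map f xs)

∑-cong : {f g : A → ℕ} → (∀ x → f x ≡ g x) → ∀ xs → ∑ f xs ≡ ∑ g xs
∑-cong f≗g []       = refl
∑-cong f≗g (x ∷ xs) = cong₂ _+_ (f≗g x) (∑-cong f≗g xs)

∑-mono : {f g : A → ℕ} → (∀ x → f x ≤ g x) → ∀ xs → ∑ f xs ≤ ∑ g xs
∑-mono f≤g []       = z≤n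
∑-mono f≤g (x ∷ xs) = +-mono-≤ (f≤g x) (∑-mono f≤g xs)

∑-+ : (f g : A → ℕ) → ∀ xs → ∑ (λ x → f x + g x) xs ≡ ∑ f xs + ∑ g xs
∑-+ f g []       = refl
∑-+ f g (x ∷ xs) rewrite ∑-+ f g xs =
  interchange (f x) (g x) (∑ f xs) (∑ g xs)

∑-*ˡ : ∀ c (f : A → ℕ) xs → ∑ (λ x → c * f x) xs ≡ c * ∑ f xs
∑-*ˡ c f []       = sym (*-zeroʳ c)
∑-*ˡ c f (x ∷ xs) rewrite ∑-*ˡ c f xs = sym (*-distribˡ-+ c (f x) (∑ f xs))

∑-const : ∀ c (xs : List A) → ∑ (λ _ → c) xs ≡ length xs * c
∑-const c []       = refl
∑-const c (x ∷ xs) = cong (c +_) (∑-const c xs)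

∑-1 : (xs : List A) → ∑ (λ _ → 1) xs ≡ length xs
∑-1 xs = trans (∑-const 1 xs) (*-identityʳ _)

∑-++ : (f : A → ℕ) → ∀ xs ys → ∑ f (xs ++ ys) ≡ ∑ f xs + ∑ f ys
∑-++ f xs ys rewrite map-++ f xs ys = sum-++ (map f xs) (map f ys)

∑-map : (f : B → ℕ) (g : A → B) → ∀ xs → ∑ f (map g xs) ≡ ∑ (f ∘ g) xs
∑-map f g xs = cong sum (sym (map-∘ xs))

∑-cartesianProduct : (f : A → ℕ) (g : B → ℕ) → ∀ xs ys →
  ∑ (λ z → f (proj₁ z) * g (proj₂ z)) (cartesianProduct xs ys) ≡ ∑ f xs * ∑ g ys
∑-cartesianProduct f g []       ys = refl
∑-cartesianProduct f g (x ∷ xs) ys = trans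
  (∑-++ h (map (x ,_) ys) (cartesianProduct xs ys))
  (trans (cong₂ _+_ (trans (∑-map h (x ,_) ys) (∑-*ˡ (f x) g ys)) (∑-cartesianProduct f g xs ys))
         (sym (*-distribʳ-+ (∑ g ys) (f x) (∑ f xs))))
  where
  h = λ z → f (proj₁ z) * g (proj₂ z)

ind : Bool → ℕ
ind true  = 1
ind false = 0

ind-∧ : ∀ a b → ind (a ∧ b) ≡ ind a * ind b
ind-∧ true  b = sym (+-identityʳ (ind b))
ind-∧ false b = refl

member≤∑ : (f : A → ℕ) → ∀ {x xs} → x ∈ xs → f x ≤ ∑ f xs
member≤∑ f (here refl)              = m≤m+n _ _
member≤∑ f {xs = y ∷ _} (there x∈) = ≤-trans (member≤∑ f x∈) (m≤n+m _ (f y))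

length-filter : {P : A → Set} (P? : ∀ x → Dec (P x)) → ∀ xs →
  length (filter P? xs) ≡ ∑ (λ x → ind (does (P? x))) xs
length-filter P? [] = refl
length-filter P? (x ∷ xs) with does (P? x)
... | true  = cong suc (length-filter P? xs)
... | false = length-filter P? xs

-- Sums over the sublists of a given length

-- Choosing `x` moves it into the weight `f ∘ (x ∷_)`, so inductions over the list must quantify
-- over all weights. For constant weight the recursion is Pascal's rule.
subsetSum : (List A → ℕ) → ℕ → List A → ℕ
subsetSum f zero    xs       = f []
subsetSum f (suc i) []       = 0
subsetSum f (suc i) (x ∷ xs) = subsetSum f (suc i) xs + subsetSum (f ∘ (x ∷_)) i xs

∑-sublists : (f : List A → Bool) → ∀ i xs →
  ∑ (λ U → ind ((length U ≡ᵇ i) ∧ f U)) (sublists xs) ≡ subsetSum (ind ∘ f) i xs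
∑-sublists f zero    []       = +-identityʳ _
∑-sublists f (suc i) []       = refl
-- The sublists that contain `x` are not empty, so their half is a sum of zeros, which the rewrites
-- remove.
∑-sublists f zero    (x ∷ xs)
  rewrite ∑-++ (λ U → ind ((length U ≡ᵇ 0) ∧ f U)) (sublists xs) (map (x ∷_) (sublists xs))
        | ∑-map (λ U → ind ((length U ≡ᵇ 0) ∧ f U)) (x ∷_) (sublists xs)
        | ∑-const 0 (sublists xs)
        | *-zeroʳ (length (sublists xs))
        | +-identityʳ (∑ (λ U → ind ((length U ≡ᵇ 0) ∧ f U)) (sublists xs))
  = ∑-sublists f zero xs
∑-sublists f (suc i) (x ∷ xs)
  rewrite ∑-++ (λ U → ind ((length U ≡ᵇ suc i) ∧ f U)) (sublists xs) (map (x ∷_) (sublists xs))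
        | ∑-map (λ U → ind ((length U ≡ᵇ suc i) ∧ f U)) (x ∷_) (sublists xs)
  = cong₂ _+_ (∑-sublists f (suc i) xs) (∑-sublists (f ∘ (x ∷_)) i xs)

subsetSum-mono : {f g : List A → ℕ} → (∀ U → f U ≤ g U) →
  ∀ i xs → subsetSum f i xs ≤ subsetSum g i xs
subsetSum-mono f≤g zero    xs       = f≤g []
subsetSum-mono f≤g (suc i) []       = z≤n
subsetSum-mono f≤g (suc i) (x ∷ xs) =
  +-mono-≤ (subsetSum-mono f≤g (suc i) xs) (subsetSum-mono (f≤g ∘ (x ∷_)) i xs)

subsetSum-+ : (f g : List A → ℕ) → ∀ i xs →
  subsetSum (λ U → f U + g U) i xs ≡ subsetSum f i xs + subsetSum g i xs
subsetSum-+ f g zero    xs = refl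
subsetSum-+ f g (suc i) [] = refl
subsetSum-+ f g (suc i) (x ∷ xs)
  rewrite subsetSum-+ f g (suc i) xs
        | subsetSum-+ (f ∘ (x ∷_)) (g ∘ (x ∷_)) i xs
  = interchange (subsetSum f (suc i) xs) (subsetSum g (suc i) xs) _ _

subsetSum-0 : ∀ i (xs : List A) → subsetSum (λ _ → 0) i xs ≡ 0
subsetSum-0 zero    xs       = refl
subsetSum-0 (suc i) []       = refl
subsetSum-0 (suc i) (x ∷ xs) = cong₂ _+_ (subsetSum-0 (suc i) xs) (subsetSum-0 i xs)

subsetSum-∑ : (g : B → List A → ℕ) → ∀ vs i xs →
  subsetSum (λ U → ∑ (λ v → g v U) vs) i xs ≡ ∑ (λ v → subsetSum (g v) i xs) vs
subsetSum-∑ g []       i xs = subsetSum-0 i xs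
subsetSum-∑ g (v ∷ vs) i xs =
  trans (subsetSum-+ (g v) (λ U → ∑ (λ w → g w U) vs) i xs)
        (cong (subsetSum (g v) i xs +_) (subsetSum-∑ g vs i xs))

subsetSum-1 : ∀ i (xs : List A) → subsetSum (λ _ → 1) i xs ≡ length xs C i
subsetSum-1 zero    xs       = refl
subsetSum-1 (suc i) []       = refl
subsetSum-1 (suc i) (x ∷ xs) = trans
  (cong₂ _+_ (subsetSum-1 (suc i) xs) (subsetSum-1 i xs))
  (trans (+-comm (length xs C suc i) _) (nCk+nC[k+1]≡[n+1]C[k+1] (length xs) i))

-- If `P x` fails, every sublist containing `x` is rejected and its summand vanishes; if it holds,
-- the two summands combine by Pascal's rule.
subsetSum-all : {P : A → Set} (P? : ∀ x → Dec (P x)) → ∀ i xs →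
  subsetSum (λ U → ind (does (all? P? U))) i xs ≡ ∑ (λ x → ind (does (P? x))) xs C i
subsetSum-all P? zero    xs = refl
subsetSum-all P? (suc i) [] = refl
subsetSum-all P? (suc i) (x ∷ xs) with does (P? x)
... | false = trans (cong₂ _+_ (subsetSum-all P? (suc i) xs) (subsetSum-0 i xs)) (+-identityʳ _)
... | true  = trans
  (cong₂ _+_ (subsetSum-all P? (suc i) xs) (subsetSum-all P? i xs))
  (trans (+-comm (count C suc i) _) (nCk+nC[k+1]≡[n+1]C[k+1] count i))
  where count = ∑ (λ x → ind (does (P? x))) xs

Monotone : (List A → ℕ) → Set
Monotone f = ∀ U W → U ⊆ W → f U ≤ f W

-- Splitting by the first element, the two inductive hypotheses and f U ≤ f (x ∷ U)
-- add up to the claim.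
subsetSum-step : (f : List A → ℕ) → Monotone f → ∀ i xs →
  (length xs ∸ i) * subsetSum f i xs ≤ suc i * subsetSum f (suc i) xs
subsetSum-step f mono i    [] rewrite 0∸n≡0 i = z≤n
subsetSum-step f mono zero (x ∷ xs) = begin
  f [] + length xs * f []                      ≤⟨ +-mono-≤ (mono [] (x ∷ []) λ ()) (subsetSum-step f mono 0 xs) ⟩
  f (x ∷ []) + 1 * subsetSum f 1 xs            ≡⟨ lemma (f (x ∷ [])) (subsetSum f 1 xs) ⟩
  1 * (subsetSum f 1 xs + f (x ∷ []))          ∎
  where
  open ≤-Reasoning
  lemma : ∀ a b → a + 1 * b ≡ 1 * (b + a)
  lemma = solve-∀
subsetSum-step f mono (suc i) (x ∷ xs) = begin
  (n ∸ i) * (a + b)                            ≡⟨ *-distribˡ-+ (n ∸ i) a b ⟩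
  (n ∸ i) * a + (n ∸ i) * b                    ≤⟨ +-mono-≤ (*-monoˡ-≤ a n∸i≤) (subsetSum-step f∷ mono∷ i xs) ⟩
  suc (n ∸ suc i) * a + suc i * b′             ≤⟨ +-monoˡ-≤ (suc i * b′) (+-mono-≤ a≤b′ (subsetSum-step f mono (suc i) xs)) ⟩
  b′ + suc (suc i) * a′ + suc i * b′           ≡⟨ lemma i a′ b′ ⟩
  suc (suc i) * (a′ + b′)                      ∎
  where
  open ≤-Reasoning
  f∷ = f ∘ (x ∷_)
  mono∷ : Monotone f∷
  mono∷ U W U⊆W = mono (x ∷ U) (x ∷ W) (∷⁺ʳ x U⊆W)
  n  = length xs
  a  = subsetSum f (suc i) xs
  b  = subsetSum f∷ i xs
  a′ = subsetSum f (suc (suc i)) xs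
  b′ = subsetSum f∷ (suc i) xs
  a≤b′ : a ≤ b′
  a≤b′ = subsetSum-mono (λ U → mono U (x ∷ U) (xs⊆x∷xs U x)) (suc i) xs
  n∸i≤ : n ∸ i ≤ suc (n ∸ suc i)
  n∸i≤ = subst (λ m → n ∸ i ≤ suc m) (pred[m∸n]≡m∸[1+n] n i) (m≤n+m∸n (n ∸ i) 1)
  lemma : ∀ i a b → b + suc (suc i) * a + suc i * b ≡ suc (suc i) * (a + b)
  lemma = solve-∀

-- Unimodal sequences

unimodal : ∀ (a : ℕ → ℕ) m → (∀ i → suc i ≤ m → a i ≤ a (suc i)) →
  (∀ i → m ≤ i → a (suc i) ≤ a i) → Unimodal a
unimodal a m up down = m , increasing , decreasing
  where
  increasing : ∀ i j → i ≤ j → j ≤ m → a i ≤ a j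
  increasing i j i≤j j≤m with m≤n⇒m<n∨m≡n i≤j
  increasing i (suc j) _ j≤m | inj₁ (s≤s i≤j) =
    ≤-trans (increasing i j i≤j (≤-trans (n≤1+n j) j≤m)) (up j j≤m)
  ... | inj₂ refl = ≤-refl
  decreasing : ∀ i j → m ≤ i → i ≤ j → a j ≤ a i
  decreasing i j m≤i i≤j with m≤n⇒m<n∨m≡n i≤j
  decreasing i (suc j) m≤i _ | inj₁ (s≤s i≤j) =
    ≤-trans (down j (≤-trans m≤i i≤j)) (decreasing i j m≤i i≤j)
  ... | inj₂ refl = ≤-refl

-- Comparing a (k - 1) with a k decides where the mode is.
unimodal-gap : ∀ (a : ℕ → ℕ) k → (∀ i → 2 + i ≤ k → a i ≤ a (suc i)) →
  (∀ i → k ≤ i → a (suc i) ≤ a i) → Unimodal a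
unimodal-gap a zero    up down = unimodal a 0 (λ _ ()) down
unimodal-gap a (suc k) up down with ≤-total (a k) (a (suc k))
... | inj₁ ak≤ = unimodal a (suc k) up′ down
  where
  up′ : ∀ i → suc i ≤ suc k → a i ≤ a (suc i)
  up′ i i<k with m≤n⇒m<n∨m≡n i<k
  ... | inj₁ i+1<k = up i i+1<k
  ... | inj₂ refl  = ak≤
... | inj₂ ak≥ = unimodal a k (λ i i<k → up i (s≤s i<k)) down′
  where
  down′ : ∀ i → k ≤ i → a (suc i) ≤ a i
  down′ i k≤i with m≤n⇒m<n∨m≡n k≤i
  ... | inj₁ k<i  = down i k<i
  ... | inj₂ refl = ak≥

-- Binomial coefficients

absorption : ∀ n k → suc k * (suc n C suc k) ≡ suc n * (n C k)
absorption zero    zero    = refl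
absorption zero    (suc k) = trans (cong (suc (suc k) *_) (k>n⇒nCk≡0 {1} {suc (suc k)} (s≤s (s≤s z≤n))))
                                   (*-zeroʳ (suc (suc k)))
absorption (suc n) zero    = begin
  1 * (suc (suc n) C 1)              ≡⟨ cong (1 *_) (nCk+nC[k+1]≡[n+1]C[k+1] (suc n) 0) ⟨
  1 * (1 + (suc n C 1))              ≡⟨ *-distribˡ-+ 1 1 (suc n C 1) ⟩
  1 + 1 * (suc n C 1)                ≡⟨ cong suc (absorption n 0) ⟩
  suc (suc n) * 1                    ∎
  where open ≡-Reasoning
absorption (suc n) (suc k) = begin
  suc (suc k) * (suc (suc n) C suc (suc k))  ≡⟨ cong (suc (suc k) *_) (nCk+nC[k+1]≡[n+1]C[k+1] (suc n) (suc k)) ⟨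
  suc (suc k) * (b + c)                      ≡⟨ lemma k b c ⟩
  b + (suc k * b + suc (suc k) * c)          ≡⟨ cong (b +_) (cong₂ _+_ (absorption n k) (absorption n (suc k))) ⟩
  b + (suc n * (n C k) + suc n * (n C suc k)) ≡⟨ cong (b +_) (*-distribˡ-+ (suc n) (n C k) (n C suc k)) ⟨
  b + suc n * (n C k + n C suc k)            ≡⟨ cong (λ x → b + suc n * x) (nCk+nC[k+1]≡[n+1]C[k+1] n k) ⟩
  suc (suc n) * b                            ∎
  where
  open ≡-Reasoning
  b = suc n C suc k
  c = suc n C suc (suc k)
  lemma : ∀ k b c → suc (suc k) * (b + c) ≡ b + (suc k * b + suc (suc k) * c)
  lemma = solve-∀

-- The upper index n is written `j + k` so that n - k needs no truncated subtraction. Pascal's rule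
-- and `absorption` give (k + 1)(b + c) = (n + 1) b, and (k + 1) b cancels.
nextC : ∀ j k → suc k * ((j + k) C suc k) ≡ j * ((j + k) C k)
nextC j k = +-cancelˡ-≡ (suc k * b) _ _ (begin
  suc k * b + suc k * c          ≡⟨ *-distribˡ-+ (suc k) b c ⟨
  suc k * (b + c)                ≡⟨ cong (suc k *_) (nCk+nC[k+1]≡[n+1]C[k+1] (j + k) k) ⟩
  suc k * (suc (j + k) C suc k)  ≡⟨ absorption (j + k) k ⟩
  suc (j + k) * b                ≡⟨ lemma j k b ⟩
  suc k * b + j * b              ∎)
  where
  open ≡-Reasoning
  b = (j + k) C k
  c = (j + k) C suc k
  lemma : ∀ j k b → suc (j + k) * b ≡ suc k * b + j * b
  lemma = solve-∀

previousC : ∀ j k → suc (j + k) * ((j + k) C suc k) ≡ j * (suc (j + k) C suc k)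
previousC j k = *-cancelˡ-≡ _ _ (suc k) (begin
  suc k * (suc (j + k) * ((j + k) C suc k))  ≡⟨ x∙yz≈y∙xz (suc k) (suc (j + k)) _ ⟩
  suc (j + k) * (suc k * ((j + k) C suc k))  ≡⟨ cong (suc (j + k) *_) (nextC j k) ⟩
  suc (j + k) * (j * ((j + k) C k))          ≡⟨ x∙yz≈y∙xz (suc (j + k)) j _ ⟩
  j * (suc (j + k) * ((j + k) C k))          ≡⟨ cong (j *_) (absorption (j + k) k) ⟨
  j * (suc k * (suc (j + k) C suc k))        ≡⟨ x∙yz≈y∙xz j (suc k) _ ⟩
  suc k * (j * (suc (j + k) C suc k))        ∎)
  where open ≡-Reasoning

-- By `nextC` the ratio of the two sides is (n - k) / (k + 1), which the hypothesis keeps at most 1.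
-- Beyond k = n the left side vanishes.
C-suc≤C : ∀ n k → n ≤ suc (k + k) → n C suc k ≤ n C k
C-suc≤C n k n≤2k+1 with n ≤? k
... | yes n≤k rewrite k>n⇒nCk≡0 (s≤s n≤k) = z≤n
... | no  n≰k = subst (λ m → m C suc k ≤ m C k) (m∸n+n≡m k≤n) (*-cancelˡ-≤ (suc k) (begin
  suc k * ((j + k) C suc k)   ≡⟨ nextC j k ⟩
  j * ((j + k) C k)           ≤⟨ *-monoˡ-≤ _ (+-cancelʳ-≤ k j (suc k) (subst (_≤ suc (k + k)) (sym (m∸n+n≡m k≤n)) n≤2k+1)) ⟩
  suc k * ((j + k) C k)       ∎))
  where
  open ≤-Reasoning
  k≤n = ≰⇒≥ n≰k
  j = n ∸ k

C-monoˡ-≤ : ∀ k {m n} → m ≤ n → m C k ≤ n C k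
C-monoˡ-≤ zero    m≤n = ≤-refl
C-monoˡ-≤ (suc k) {m} {n} z≤n rewrite k>n⇒nCk≡0 {0} {suc k} (s≤s z≤n) = z≤n
C-monoˡ-≤ (suc k) {suc m} {suc n} (s≤s m≤n) = subst₂ _≤_
  (nCk+nC[k+1]≡[n+1]C[k+1] m k) (nCk+nC[k+1]≡[n+1]C[k+1] n k)
  (+-mono-≤ (C-monoˡ-≤ k m≤n) (C-monoˡ-≤ (suc k) m≤n))

-- Pascal's rule splits the right side into two neighbours of row n - 1; past the middle of that
-- row, the left neighbour is at least the right one. Hence each removed point at least halves the
-- count, and `2^*C≤C` iterates this.
2*C[n∸1]≤C : ∀ n k → n ≤ suc k + suc k → 2 * ((n ∸ 1) C suc k) ≤ n C suc k
2*C[n∸1]≤C zero    k _ rewrite k>n⇒nCk≡0 {0} {suc k} (s≤s z≤n) = z≤n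
2*C[n∸1]≤C (suc n) k (s≤s n≤) = begin
  n C suc k + (n C suc k + 0)  ≡⟨ cong (n C suc k +_) (+-identityʳ _) ⟩
  n C suc k + n C suc k        ≤⟨ +-monoˡ-≤ _ (C-suc≤C n k (≤-trans n≤ (≤-reflexive (+-suc k k)))) ⟩
  n C k + n C suc k            ≡⟨ nCk+nC[k+1]≡[n+1]C[k+1] n k ⟩
  suc n C suc k                ∎
  where open ≤-Reasoning

2^*C≤C : ∀ d n k → n ≤ suc k + suc k → 2 ^ d * ((n ∸ d) C suc k) ≤ n C suc k
2^*C≤C zero    n k n≤ = ≤-reflexive (*-identityˡ _)
2^*C≤C (suc d) n k n≤ = begin
  2 ^ suc d * ((n ∸ suc d) C suc k)      ≡⟨ cong (λ m → 2 ^ suc d * (m C suc k)) (pred[m∸n]≡m∸[1+n] n d) ⟨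
  2 * 2 ^ d * ((n ∸ d ∸ 1) C suc k)      ≡⟨ xy∙z≈y∙xz 2 (2 ^ d) _ ⟩
  2 ^ d * (2 * ((n ∸ d ∸ 1) C suc k))    ≤⟨ *-monoʳ-≤ (2 ^ d) (2*C[n∸1]≤C (n ∸ d) k (≤-trans (m∸n≤m n d) n≤)) ⟩
  2 ^ d * ((n ∸ d) C suc k)              ≤⟨ 2^*C≤C d n k n≤ ⟩
  n C suc k                              ∎
  where open ≤-Reasoning

-- The numerical condition on order and degree

record Balanced (n d : ℕ) : Set where
  constructor balanced
  field
    k       : ℕ
    k-small : k + k ≤ 3 + n
    bound   : n C suc k + n * ((n ∸ suc d) C k) ≤ n C k

-- At k = 1 both C(n, 2) and the correction term are 0, whatever `d` is.
balanced-≤1 : ∀ n d → n ≤ 1 → Balanced n d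
balanced-≤1 zero          d _ = balanced 1 (s≤s (s≤s z≤n)) ≤-refl
balanced-≤1 (suc zero)    d _ = balanced 1 (s≤s (s≤s z≤n)) (≤-trans (≤-reflexive (cong (λ m → 1 * (m C 1)) (0∸n≡0 d))) z≤n)
balanced-≤1 (suc (suc _)) d (s≤s ())

-- Both terms on the left of `bound` are compared with c = C(n, k+1). The first is c · j / K by
-- `nextC`; the second is at most c · j / 2^d by halving d times and `previousC`. So K j ≤ 2^d (K -
-- j) suffices, and K - j ≥ 3 because j < k.
balanced-at : ∀ d j k → suc j ≤ k → suc (suc k) * j ≤ 3 * 2 ^ d →
  suc k + suc k ≤ 3 + (j + suc k) → Balanced (j + suc k) d
balanced-at d j k j<k H k-small = balanced (suc k) k-small (*-cancelˡ-≤ (2 ^ d * suc (suc k)) {{m*n≢0 (2 ^ d) (suc (suc k)) {{m^n≢0 2 d}}}} (begin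
  2 ^ d * K * (n C suc (suc k) + n * r)           ≡⟨ distribute (2 ^ d) K (n C suc (suc k)) n r ⟩
  2 ^ d * (K * (n C suc (suc k))) + K * (n * (2 ^ d * r))
                                                  ≤⟨ +-monoʳ-≤ (2 ^ d * (K * (n C suc (suc k)))) (*-monoʳ-≤ K (*-monoʳ-≤ n bound₁)) ⟩
  2 ^ d * (K * (n C suc (suc k))) + K * (n * ((n ∸ 1) C suc k))
                                                  ≡⟨ cong₂ (λ x y → 2 ^ d * x + K * y) (nextC j (suc k)) previous ⟩
  2 ^ d * (j * c) + K * (j * c)                   ≡⟨ collect (2 ^ d) j c K ⟩
  (K * j + 2 ^ d * j) * c                         ≤⟨ *-monoˡ-≤ c H′ ⟩
  2 ^ d * K * c                                   ∎))
  where
  open ≤-Reasoning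
  n = j + suc k
  K = suc (suc k)
  r = (n ∸ suc d) C suc k
  c = n C suc k
  H′ : K * j + 2 ^ d * j ≤ 2 ^ d * K
  H′ = begin
    K * j + 2 ^ d * j      ≤⟨ +-monoˡ-≤ _ H ⟩
    3 * 2 ^ d + 2 ^ d * j  ≡⟨ factor (2 ^ d) j ⟩
    2 ^ d * (3 + j)        ≤⟨ *-monoʳ-≤ (2 ^ d) (s≤s (s≤s j<k)) ⟩
    2 ^ d * K              ∎
    where
    factor : ∀ p j → 3 * p + p * j ≡ p * (3 + j)
    factor = solve-∀
  previous : n * ((n ∸ 1) C suc k) ≡ j * c
  previous = subst (λ m → m * ((m ∸ 1) C suc k) ≡ j * (m C suc k)) (sym (+-suc j k)) (previousC j k)
  bound₁ : 2 ^ d * r ≤ (n ∸ 1) C suc k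
  bound₁ = subst (λ m → 2 ^ d * (m C suc k) ≤ (n ∸ 1) C suc k) (∸-+-assoc n 1 d)
    (2^*C≤C d (n ∸ 1) k (≤-trans (m∸n≤m n 1) (+-monoˡ-≤ (suc k) (≤-trans (n≤1+n j) (≤-trans j<k (n≤1+n k))))))
  distribute : ∀ p K x n r → p * K * (x + n * r) ≡ p * (K * x) + K * (n * (p * r))
  distribute = solve-∀
  collect : ∀ p j c K → p * (j * c) + K * (j * c) ≡ (K * j + p * j) * c
  collect = solve-∀

even-or-odd : ∀ n → ∃ λ j → (n ≡ j + j) ⊎ (n ≡ suc (j + j))
even-or-odd zero = 0 , inj₁ refl
even-or-odd (suc n) with even-or-odd n
... | j , inj₁ refl = j , inj₂ refl
... | j , inj₂ refl = suc j , inj₁ (cong suc (sym (+-suc j j)))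

-- The threshold is ⌊(n + 3) / 2⌋, the largest that `k-small` allows: j + 2 for order 2j + 2, and j
-- + 3 for order 2j + 3. The product K j required by `balanced-at` is then less than (n + 2)² / 4.
balanced-large : ∀ n d → (2 + n) * (2 + n) ≤ 12 * 2 ^ d → Balanced n d
balanced-large zero          d _ = balanced-≤1 0 d z≤n
balanced-large (suc zero)    d _ = balanced-≤1 1 d ≤-refl
balanced-large (suc (suc n)) d H with even-or-odd n
... | j , inj₁ refl = subst (λ n → Balanced n d) (size j)
  (balanced-at d j (suc j) ≤-refl (*-cancelˡ-≤ 4 (begin
    4 * (suc (suc (suc j)) * j)                ≤⟨ m≤m+n _ (16 + 4 * j) ⟩
    4 * (suc (suc (suc j)) * j) + (16 + 4 * j) ≡⟨ square j ⟩
    (4 + (j + j)) * (4 + (j + j))              ≤⟨ H ⟩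
    12 * 2 ^ d                                 ≡⟨ *-assoc 4 3 (2 ^ d) ⟩
    4 * (3 * 2 ^ d)                            ∎))
    (≤-trans (n≤1+n _) (≤-reflexive (rearrange j))))
  where
  open ≤-Reasoning
  size : ∀ j → j + suc (suc j) ≡ suc (suc (j + j))
  size = solve-∀
  square : ∀ j → 4 * (suc (suc (suc j)) * j) + (16 + 4 * j) ≡ (4 + (j + j)) * (4 + (j + j))
  square = solve-∀
  rearrange : ∀ j → suc (suc (suc j) + suc (suc j)) ≡ 3 + (j + suc (suc j))
  rearrange = solve-∀
... | j , inj₂ refl = subst (λ n → Balanced n d) (size j)
  (balanced-at d j (suc (suc j)) (n≤1+n _) (*-cancelˡ-≤ 4 (begin
    4 * (suc (suc (suc (suc j))) * j)                ≤⟨ m≤m+n _ (25 + 4 * j) ⟩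
    4 * (suc (suc (suc (suc j))) * j) + (25 + 4 * j) ≡⟨ square j ⟩
    (5 + (j + j)) * (5 + (j + j))                    ≤⟨ H ⟩
    12 * 2 ^ d                                       ≡⟨ *-assoc 4 3 (2 ^ d) ⟩
    4 * (3 * 2 ^ d)                                  ∎))
    (≤-reflexive (rearrange j)))
  where
  open ≤-Reasoning
  size : ∀ j → j + suc (suc (suc j)) ≡ suc (suc (suc (j + j)))
  size = solve-∀
  square : ∀ j → 4 * (suc (suc (suc (suc j))) * j) + (25 + 4 * j) ≡ (5 + (j + j)) * (5 + (j + j))
  square = solve-∀
  rearrange : ∀ j → suc (suc (suc j)) + suc (suc (suc j)) ≡ 3 + (j + suc (suc (suc j)))
  rearrange = solve-∀

-- Orders and degrees of products of complete graphs

-- Multiplied by 4, the second part is the hypothesis of `balanced-large` for order 2n and degree d,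
-- so it leaves room for one factor K₂. The bound 4 ≤ d pays for tripling the order in `large-3`.
Large : ℕ → ℕ → Set
Large n d = 4 ≤ d × suc n * suc n ≤ 3 * 2 ^ d

-- Since n′ + 1 ≤ 2 (n + 1), the square grows at most fourfold, and two more units of degree
-- quadruple the power of 2.
large-grow : ∀ {n d n′ d′} → Large n d → n′ ≤ suc (n + n) → 2 + d ≤ d′ → Large n′ d′
large-grow {n} {d} {n′} {d′} (4≤d , H) n′≤ d+2≤d′ =
  ≤-trans 4≤d (≤-trans (m≤n+m d 2) d+2≤d′) , (begin
    suc n′ * suc n′                          ≤⟨ *-mono-≤ (s≤s n′≤) (s≤s n′≤) ⟩
    (2 + (n + n)) * (2 + (n + n))            ≡⟨ double n ⟩
    4 * (suc n * suc n)                      ≤⟨ *-monoʳ-≤ 4 H ⟩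
    4 * (3 * 2 ^ d)                          ≡⟨ quadruple (2 ^ d) ⟩
    3 * 2 ^ (2 + d)                          ≤⟨ *-monoʳ-≤ 3 (^-monoʳ-≤ 2 d+2≤d′) ⟩
    3 * 2 ^ d′                               ∎)
  where
  open ≤-Reasoning
  double : ∀ n → (2 + (n + n)) * (2 + (n + n)) ≡ 4 * (suc n * suc n)
  double = solve-∀
  quadruple : ∀ p → 4 * (3 * p) ≡ 3 * (2 * (2 * p))
  quadruple = solve-∀

-- One more vertex in the factor adds n to the order, at most doubling it, and d ≥ 2 to the degree;
-- `large-grow` covers each such enlargement.
large-factor : ∀ c n d → 2 ≤ d → Large (suc c * n) (c * d) →
  ∀ e → Large ((suc c + e) * n) ((c + e) * d)
large-factor c n d 2≤d base zero rewrite +-identityʳ c = base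
large-factor c n d 2≤d base (suc e) rewrite +-suc c e =
  large-grow {(suc c + e) * n} (large-factor c n d 2≤d base e)
    (≤-trans (+-monoˡ-≤ _ (m≤m+n n _)) (n≤1+n _))
    (+-monoˡ-≤ _ 2≤d)

-- Two uses of `large-grow` reach order 4n + 3 ≥ 3n at a cost of 4 in the degree, which the gain of
-- d ≥ 4 covers.
large-3 : ∀ {n d} → Large n d → Large (3 * n) (2 * d)
large-3 {n} {d} L@(4≤d , _) = large-grow {suc (n + n)}
  (large-grow {n} L ≤-refl ≤-refl)
  (≤-trans (m≤m+n (3 * n) (3 + n)) (≤-reflexive (rearrange n)))
  (≤-trans (+-monoˡ-≤ d 4≤d) (≤-reflexive (cong (d +_) (sym (+-identityʳ d)))))
  where
  rearrange : ∀ n → 3 * n + (3 + n) ≡ suc (suc (n + n) + suc (n + n))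
  rearrange = solve-∀

large-K : ∀ e → Large (5 + e) (4 + e)
large-K e = m≤m+n 4 e , bound e
  where
  open ≤-Reasoning
  expand : ∀ e → (7 + e) * (7 + e) + (23 + 10 * e + e * e) ≡ 2 * ((6 + e) * (6 + e))
  expand = solve-∀
  bound : ∀ e → (6 + e) * (6 + e) ≤ 3 * 2 ^ (4 + e)
  -- The family starts at K₅ because K₄ just fails: 5² = 25 > 24 = 3 · 2³.
  bound zero    = toWitness {a? = 36 ≤? 48} tt
  bound (suc e) rewrite +-suc 6 e = begin
    (7 + e) * (7 + e)                            ≤⟨ m≤m+n _ (23 + 10 * e + e * e) ⟩
    (7 + e) * (7 + e) + (23 + 10 * e + e * e)    ≡⟨ expand e ⟩
    2 * ((6 + e) * (6 + e))                      ≤⟨ *-monoʳ-≤ 2 (bound e) ⟩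
    2 * (3 * 2 ^ (4 + e))                        ≡⟨ x∙yz≈y∙xz 2 3 (2 ^ (4 + e)) ⟩
    3 * 2 ^ (5 + e)                              ∎

-- Order and degree of a product of factors K_c with c ≥ 3.
data OrderDegree : ℕ → ℕ → Set where
  empty : OrderDegree 1 1
  K₃    : OrderDegree 3 2
  K₄    : OrderDegree 4 3
  K₃²   : OrderDegree 9 4
  K₃³   : OrderDegree 27 8
  large : ∀ {n d} → Large n d → OrderDegree n d

-- The exceptions are closed up to `Large`: a product with one more factor is again listed, is a
-- single K₅ or larger, or grows by `large-factor` from order 12 (K₃ × K₄), 36 (K₃² × K₄) or 81
-- (K₃⁴). K₃³ must be listed, since 28² = 784 > 768 = 3 · 2⁸.
orderDegree-* : ∀ c {n d} → 3 ≤ c → OrderDegree n d → OrderDegree (c * n) (pred c * d)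
orderDegree-* (suc (suc (suc c))) (s≤s (s≤s (s≤s z≤n))) = step c
  where
  factor : ∀ c n d → 2 ≤ d → Large (suc c * n) (c * d) →
    ∀ e → OrderDegree ((suc c + e) * n) ((c + e) * d)
  factor c n d 2≤d base e = large (large-factor c n d 2≤d base e)
  numeric : ∀ n d → {True (4 ≤? d)} → {True (suc n * suc n ≤? 3 * 2 ^ d)} → Large n d
  numeric n d {p} {q} = toWitness p , toWitness q
  step : ∀ e {n d} → OrderDegree n d → OrderDegree ((3 + e) * n) ((2 + e) * d)
  step 0             empty = K₃
  step 1             empty = K₄
  step (suc (suc e)) empty =
    large (subst₂ Large (sym (*-identityʳ (5 + e))) (sym (*-identityʳ (4 + e))) (large-K e))
  step 0             K₃  = K₃²
  step (suc e)       K₃  = factor 3 3 2 (m≤m+n 2 _) (numeric 12 6) e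
  step e             K₄  = factor 2 4 3 (m≤m+n 2 _) (numeric 12 6) e
  step 0             K₃² = K₃³
  step (suc e)       K₃² = factor 3 9 4 (m≤m+n 2 _) (numeric 36 12) e
  step e             K₃³ = factor 2 27 8 (m≤m+n 2 _) (numeric 81 16) e
  step e {n} {d} (large L@(4≤d , _)) =
    factor 2 n d (≤-trans (s≤s (s≤s z≤n)) 4≤d) (large-3 {n} L) e

-- Settles the exceptional pairs by evaluation. The thresholds supplied below are again ⌊(n + 3) /
-- 2⌋, except 1 and 2 at orders 1 and 3.
check : ∀ n d k → {True (k + k ≤? 3 + n)} → {True (n C suc k + n * ((n ∸ suc d) C k) ≤? n C k)} →
  Balanced n d
check n d k {p} {q} = balanced k (toWitness p) (toWitness q)

balanced-product : ∀ {n d} → OrderDegree n d → Balanced n d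
balanced-product empty = check 1 1 1
balanced-product K₃    = check 3 2 2
balanced-product K₄    = check 4 3 3
balanced-product K₃²   = check 9 4 6
balanced-product K₃³   = check 27 8 15
balanced-product (large {n} {d} (_ , L)) = balanced-large n d (begin
  (2 + n) * (2 + n)              ≤⟨ *-mono-≤ 2+n≤ 2+n≤ ⟩
  (2 * suc n) * (2 * suc n)      ≡⟨ double (suc n) ⟩
  4 * (suc n * suc n)            ≤⟨ *-monoʳ-≤ 4 L ⟩
  4 * (3 * 2 ^ d)                ≡⟨ *-assoc 4 3 (2 ^ d) ⟨
  12 * 2 ^ d                     ∎)
  where
  open ≤-Reasoning
  2+n≤ : 2 + n ≤ 2 * suc n
  2+n≤ = s≤s (subst (suc n ≤_) (sym (+-suc n (n + 0))) (s≤s (m≤m+n n (n + 0))))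
  double : ∀ m → (2 * m) * (2 * m) ≡ 4 * (m * m)
  double = solve-∀

balanced-K₂× : ∀ {n d} → OrderDegree n d → Balanced (2 * n) d
balanced-K₂× empty = check 2 1 2
balanced-K₂× K₃    = check 6 2 4
balanced-K₂× K₄    = check 8 3 5
balanced-K₂× K₃²   = check 18 4 10
balanced-K₂× K₃³   = check 54 8 28
balanced-K₂× (large {n} {d} (_ , L)) = balanced-large (2 * n) d (begin
  (2 + 2 * n) * (2 + 2 * n)      ≡⟨ double n ⟩
  4 * (suc n * suc n)            ≤⟨ *-monoʳ-≤ 4 L ⟩
  4 * (3 * 2 ^ d)                ≡⟨ *-assoc 4 3 (2 ^ d) ⟨
  12 * 2 ^ d                     ∎)
  where
  open ≤-Reasoning
  double : ∀ n → (2 + 2 * n) * (2 + 2 * n) ≡ 4 * (suc n * suc n)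
  double = solve-∀

ind-mono : {P Q : Set} (P? : Dec P) (Q? : Dec Q) → (P → Q) → ind (does P?) ≤ ind (does Q?)
ind-mono (no _)  Q?      P⇒Q = z≤n
ind-mono (yes p) (yes _) P⇒Q = ≤-refl
ind-mono (yes p) (no ¬q) P⇒Q = contradiction (P⇒Q p) ¬q

ind-yes : {P : Set} (P? : Dec P) → P → 1 ≤ ind (does P?)
ind-yes (yes _) p = ≤-refl
ind-yes (no ¬p) p = contradiction p ¬p

-- Domination polynomials

module _ (G : FinGraph) where
  open FinGraph G using (V; _≟V_; vertices; complete; Adj; adj?; irrefl)

  near? : ∀ v u → Dec (v ≡ u ⊎ Adj u v)
  near? v u = (v ≟V u) ⊎-dec adj? u v

  far? : ∀ v u → Dec (¬ (v ≡ u ⊎ Adj u v))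
  far? v u = ¬? (near? v u)

  degree : V → ℕ
  degree v = ∑ (λ u → ind (does (adj? u v))) vertices

  isDominating : List V → ℕ
  isDominating U = ind (does (dominating? G U))

  dom≡subsetSum : ∀ i → dom G i ≡ subsetSum isDominating i vertices
  dom≡subsetSum i = trans
    (length-filter _ (sublists vertices))
    (∑-sublists (λ U → does (dominating? G U)) i vertices)

  isDominating-mono : Monotone isDominating
  isDominating-mono U W U⊆W = ind-mono (dominating? G U) (dominating? G W)
    (λ dominating v → Sum.map U⊆W (Any-resp-⊆ U⊆W) (dominating v))

  -- A vertex `v` that `U` fails to dominate has all of `U` outside its closed neighbourhood, so its
  -- summand is 1. Such a `v` is found by a decidable search through `vertices`.
  undominated-far : ∀ U → 1 ≤ isDominating U + ∑ (λ v → ind (does (all? (far? v) U))) vertices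
  undominated-far U with dominating? G U
  ... | yes _ = s≤s z≤n
  ... | no ¬dominating with Any.any? (λ v → all? (far? v) U) vertices
  ...   | yes any with find any
  ...     | v , v∈ , far = ≤-trans (ind-yes (all? (far? v) U) far) (member≤∑ (λ w → ind (does (all? (far? w) U))) v∈)
  undominated-far U | no ¬dominating | no ¬any = contradiction dominating ¬dominating
    where
    near : ∀ {v W} → Any (λ u → ¬ ¬ (v ≡ u ⊎ Adj u v)) W → v ∈ W ⊎ Any (λ u → Adj u v) W
    near {v} (here {u} ¬¬near) with decidable-stable (near? v u) ¬¬near
    ... | inj₁ v≡u = inj₁ (here v≡u)
    ... | inj₂ adj = inj₂ (here adj)
    near (there any) = Sum.map there there (near any)
    dominating : Dominating G U
    dominating v with all? (far? v) U
    ... | yes far = contradiction (lose (complete v) far) ¬any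
    ... | no ¬far = near (¬All⇒Any¬ (far? v) U ¬far)

  order : ℕ
  order = length vertices

  -- Each `u` is at most one of far from `v`, equal to `v` and adjacent to `v`, the last two being
  -- exclusive by irreflexivity. Summing the three indicators, with `v` itself counted at least
  -- once, gives the bound.
  far≤ : ∀ v → ∑ (λ u → ind (does (far? v u))) vertices ≤ order ∸ suc (degree v)
  far≤ v = m+n≤o⇒m≤o∸n _ (begin
    far + (1 + degree v)         ≤⟨ +-monoʳ-≤ far (+-monoˡ-≤ (degree v) self) ⟩
    far + (same + degree v)      ≡⟨ cong (far +_) (∑-+ (λ u → ind (does (v ≟V u))) (λ u → ind (does (adj? u v))) vertices) ⟨
    far + ∑ (λ u → ind (does (v ≟V u)) + ind (does (adj? u v))) vertices
                                 ≡⟨ ∑-+ (λ u → ind (does (far? v u))) (λ u → ind (does (v ≟V u)) + ind (does (adj? u v))) vertices ⟨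
    ∑ (λ u → ind (does (far? v u)) + (ind (does (v ≟V u)) + ind (does (adj? u v)))) vertices
                                 ≤⟨ ∑-mono disjoint vertices ⟩
    ∑ (λ _ → 1) vertices         ≡⟨ ∑-1 vertices ⟩
    order                        ∎)
    where
    open ≤-Reasoning
    far  = ∑ (λ u → ind (does (far? v u))) vertices
    same = ∑ (λ u → ind (does (v ≟V u))) vertices
    self : 1 ≤ same
    self = ≤-trans (ind-yes (v ≟V v) refl) (member≤∑ (λ u → ind (does (v ≟V u))) (complete v))
    disjoint : ∀ u → ind (does (far? v u)) + (ind (does (v ≟V u)) + ind (does (adj? u v))) ≤ 1
    disjoint u with v ≟V u | adj? u v
    ... | yes refl | yes adj = contradiction adj irrefl
    ... | yes _    | no _    = ≤-refl
    ... | no _     | yes _   = ≤-refl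
    ... | no _     | no _    = ≤-refl

  dom≤C : ∀ i → dom G i ≤ order C i
  dom≤C i = begin
    dom G i                               ≡⟨ dom≡subsetSum i ⟩
    subsetSum isDominating i vertices     ≤⟨ subsetSum-mono (λ U → ind-mono (dominating? G U) (yes tt) _) i vertices ⟩
    subsetSum (λ _ → 1) i vertices        ≡⟨ subsetSum-1 i vertices ⟩
    order C i                             ∎
    where open ≤-Reasoning

  -- A union bound: `undominated-far` is summed over all i-subsets and the sums are exchanged; each
  -- vertex then contributes the i-subsets of its at most n - d - 1 far vertices.
  C≤dom+ : ∀ d → (∀ v → d ≤ degree v) → ∀ i → order C i ≤ dom G i + order * ((order ∸ suc d) C i)
  C≤dom+ d d≤ i = begin
    order C i                                           ≡⟨ subsetSum-1 i vertices ⟨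
    subsetSum (λ _ → 1) i vertices                      ≤⟨ subsetSum-mono undominated-far i vertices ⟩
    subsetSum (λ U → isDominating U + ∑ (λ v → avoids v U) vertices) i vertices
                                                        ≡⟨ subsetSum-+ isDominating _ i vertices ⟩
    subsetSum isDominating i vertices + subsetSum (λ U → ∑ (λ v → avoids v U) vertices) i vertices
                                                        ≡⟨ cong₂ _+_ (sym (dom≡subsetSum i)) (subsetSum-∑ avoids vertices i vertices) ⟩
    dom G i + ∑ (λ v → subsetSum (avoids v) i vertices) vertices
                                                        ≤⟨ +-monoʳ-≤ (dom G i) (∑-mono few vertices) ⟩
    dom G i + ∑ (λ _ → (order ∸ suc d) C i) vertices    ≡⟨ cong (dom G i +_) (∑-const ((order ∸ suc d) C i) vertices) ⟩
    dom G i + order * ((order ∸ suc d) C i)             ∎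
    where
    open ≤-Reasoning
    avoids : V → List V → ℕ
    avoids v U = ind (does (all? (far? v) U))
    few : ∀ v → subsetSum (avoids v) i vertices ≤ (order ∸ suc d) C i
    few v = ≤-trans (≤-reflexive (subsetSum-all (far? v) i vertices))
      (C-monoˡ-≤ i (≤-trans (far≤ v) (∸-monoʳ-≤ order (s≤s (d≤ v)))))

  dom-step : ∀ i → (order ∸ i) * dom G i ≤ suc i * dom G (suc i)
  dom-step i = subst₂ (λ x y → (order ∸ i) * x ≤ suc i * y)
    (sym (dom≡subsetSum i)) (sym (dom≡subsetSum (suc i)))
    (subsetSum-step isDominating isDominating-mono i vertices)

  dom-increasing : ∀ i → suc i + i ≤ order → dom G i ≤ dom G (suc i)
  dom-increasing i 2i<n = *-cancelˡ-≤ (suc i)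
    (≤-trans (*-monoˡ-≤ (dom G i) (m+n≤o⇒m≤o∸n (suc i) 2i<n)) (dom-step i))

  -- The bound C(n, i+1) ≤ dom i, which forces dom (i+1) ≤ dom i, propagates from i to i + 1.
  C≤dom-suc : ∀ i → order C suc i ≤ dom G i → order C suc (suc i) ≤ dom G (suc i)
  C≤dom-suc i H with order ≤? suc i
  ... | yes n≤ rewrite k>n⇒nCk≡0 (s≤s n≤) = z≤n
  ... | no  n≰ = *-cancelˡ-≤ (suc i) (begin
    suc i * (order C suc (suc i))         ≤⟨ *-monoˡ-≤ _ (n≤1+n (suc i)) ⟩
    suc (suc i) * (order C suc (suc i))   ≡⟨ next ⟩
    (order ∸ suc i) * (order C suc i)     ≤⟨ *-mono-≤ (∸-monoʳ-≤ order (n≤1+n i)) H ⟩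
    (order ∸ i) * dom G i                 ≤⟨ dom-step i ⟩
    suc i * dom G (suc i)                 ∎)
    where
    open ≤-Reasoning
    next : suc (suc i) * (order C suc (suc i)) ≡ (order ∸ suc i) * (order C suc i)
    next = subst (λ m → suc (suc i) * (m C suc (suc i)) ≡ (order ∸ suc i) * (m C suc i))
      (m∸n+n≡m (≰⇒≥ n≰)) (nextC (order ∸ suc i) (suc i))

  unimodal-of-balanced : ∀ d → (∀ v → d ≤ degree v) → Balanced order d → DomPolyUnimodal G
  unimodal-of-balanced d d≤ (balanced k k-small bound) = unimodal-gap (dom G) k up down
    where
    base : order C suc k ≤ dom G k
    base = +-cancelʳ-≤ (order * ((order ∸ suc d) C k)) _ _ (≤-trans bound (C≤dom+ d d≤ k))
    above : ∀ i → k ≤ i → order C suc i ≤ dom G i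
    above i k≤i with m≤n⇒m<n∨m≡n k≤i
    above (suc i) _ | inj₁ (s≤s k≤i) = C≤dom-suc i (above i k≤i)
    ... | inj₂ refl = base
    down : ∀ i → k ≤ i → dom G (suc i) ≤ dom G i
    down i k≤i = ≤-trans (dom≤C (suc i)) (above i k≤i)
    up : ∀ i → 2 + i ≤ k → dom G i ≤ dom G (suc i)
    -- Doubling i + 2 ≤ k gives 2i + 4 ≤ 2k ≤ n + 3, hence 2i + 1 ≤ n.
    up i 2+i≤k = dom-increasing i (+-cancelˡ-≤ 3 _ _
      (≤-trans (≤-reflexive (cong (2 +_) (sym (trans (+-suc i (suc i)) (cong suc (+-suc i i))))))
        (≤-trans (+-mono-≤ 2+i≤k 2+i≤k) k-small)))

-- Products of complete graphs

length-allTuples : ∀ ns → length (allTuples ns) ≡ product ns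
length-allTuples []       = refl
length-allTuples (n ∷ ns) = begin
  length (allTuples (n ∷ ns))                                      ≡⟨ ∑-1 (allTuples (n ∷ ns)) ⟨
  ∑ (λ _ → 1) (cartesianProduct (allFin n) (allTuples ns))         ≡⟨ ∑-cartesianProduct (λ _ → 1) (λ _ → 1) (allFin n) (allTuples ns) ⟩
  ∑ (λ _ → 1) (allFin n) * ∑ (λ _ → 1) (allTuples ns)              ≡⟨ cong₂ _*_ (∑-1 (allFin n)) (∑-1 (allTuples ns)) ⟩
  length (allFin n) * length (allTuples ns)                        ≡⟨ cong₂ _*_ (length-tabulate {n = n} id) (length-allTuples ns) ⟩
  n * product ns                                                   ∎
  where open ≡-Reasoning

∑-allFin-suc : ∀ {n} (f : Fin (suc n) → ℕ) → ∑ f (allFin (suc n)) ≡ f zero + ∑ (f ∘ suc) (allFin n)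
∑-allFin-suc {n} f = cong (f zero +_) (trans (cong (∑ f) (sym (map-tabulate id suc))) (∑-map f suc (allFin n)))

differs : ∀ {n} → Fin n → Fin n → ℕ
differs y x = ind (not (does (x Fin.≟ y)))

degree-K : ∀ {n} (y : Fin n) → ∑ (differs y) (allFin n) ≡ pred n
degree-K {suc n} zero =
  trans (∑-allFin-suc {n} (differs zero)) (trans (∑-1 (allFin n)) (length-tabulate {n = n} id))
degree-K {suc (suc n)} (suc y) = trans (∑-allFin-suc (differs (suc y))) (cong suc (degree-K y))

-- The indicator of adjacency is a product of indicators, one per coordinate, so its sum over the
-- cartesian product factors. In the one-factor case the trivial tail contributes a factor 1.
degree-KProd : ∀ n ns v → degree (KProd (n ∷ ns)) v ≡ product (map pred (n ∷ ns))
degree-KProd n [] (y , tt) = begin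
  ∑ (λ z → differs y (proj₁ z)) zs      ≡⟨ ∑-cong (λ z → sym (*-identityʳ (differs y (proj₁ z)))) zs ⟩
  ∑ (λ z → differs y (proj₁ z) * 1) zs  ≡⟨ ∑-cartesianProduct (differs y) (λ _ → 1) (allFin n) (tt ∷ []) ⟩
  ∑ (differs y) (allFin n) * 1          ≡⟨ cong (_* 1) (degree-K y) ⟩
  pred n * 1                            ∎
  where
  open ≡-Reasoning
  zs = cartesianProduct (allFin n) (tt ∷ [])
degree-KProd n (m ∷ ns) (y , ys) = begin
  ∑ (λ z → ind (not (does (proj₁ z Fin.≟ y)) ∧ does (adjK? (m ∷ ns) (proj₂ z) ys))) zs
    ≡⟨ ∑-cong (λ z → ind-∧ (not (does (proj₁ z Fin.≟ y))) (does (adjK? (m ∷ ns) (proj₂ z) ys))) zs ⟩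
  ∑ (λ z → differs y (proj₁ z) * adjacent (proj₂ z)) zs
    ≡⟨ ∑-cartesianProduct (differs y) adjacent (allFin n) (allTuples (m ∷ ns)) ⟩
  ∑ (differs y) (allFin n) * degree (KProd (m ∷ ns)) ys
    ≡⟨ cong₂ _*_ (degree-K y) (degree-KProd m ns ys) ⟩
  pred n * product (map pred (m ∷ ns)) ∎
  where
  open ≡-Reasoning
  zs = cartesianProduct (allFin n) (allTuples (m ∷ ns))
  adjacent : Tuple (m ∷ ns) → ℕ
  adjacent xs = ind (does (adjK? (m ∷ ns) xs ys))

-- Consequences of connectedness for the factors

adjK⇒≢ : ∀ n ns {x y : Fin n} {xs ys} → AdjK (n ∷ ns) (x , xs) (y , ys) → x ≢ y
adjK⇒≢ n []       x≢y       = x≢y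
adjK⇒≢ n (_ ∷ _) (x≢y , _) = x≢y

Fin-≢⇒2≤ : ∀ {n} {x y : Fin n} → x ≢ y → 2 ≤ n
Fin-≢⇒2≤ {suc zero}    {zero} {zero} x≢y = contradiction refl x≢y
Fin-≢⇒2≤ {suc (suc n)} _ = s≤s (s≤s z≤n)

adjK⇒2≤ : ∀ ns {u v} → AdjK ns u v → All (2 ≤_) ns
adjK⇒2≤ []           ()
adjK⇒2≤ (n ∷ [])     x≢y         = Fin-≢⇒2≤ x≢y ∷ []
adjK⇒2≤ (n ∷ m ∷ ns) (x≢y , adj) = Fin-≢⇒2≤ x≢y ∷ adjK⇒2≤ (m ∷ ns) adj

-- Two distinct vertices are joined by a walk with at least one edge, and an edge changes every
-- coordinate, so no factor has fewer than two vertices.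
connected⇒2≤ : ∀ ns → Connected (KProd ns) → product ns ≤ 1 ⊎ All (2 ≤_) ns
connected⇒2≤ ns connected = distinct (allTuples ns) (allTuples-unique ns) (length-allTuples ns)
  where
  distinct : ∀ us → Unique us → length us ≡ product ns → product ns ≤ 1 ⊎ All (2 ≤_) ns
  distinct []          _ eq = inj₁ (≤-trans (≤-reflexive (sym eq)) z≤n)
  distinct (_ ∷ [])    _ eq = inj₁ (≤-reflexive (sym eq))
  distinct (u ∷ v ∷ _) ((u≢v ∷ _) ∷ _) _ with connected u v
  ... | ε       = contradiction refl u≢v
  ... | adj ◅ _ = inj₂ (adjK⇒2≤ ns adj)

coordinate : ∀ {n ns} → n ∈ ns → Tuple ns → Fin n
coordinate (here refl) (x , _)  = x
coordinate (there p)   (_ , xs) = coordinate p xs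

adjK-coordinate : ∀ {n} ns (p : n ∈ ns) {u v} → AdjK ns u v → coordinate p u ≢ coordinate p v
adjK-coordinate (n ∷ ns)     (here refl) adj       = adjK⇒≢ n ns adj
adjK-coordinate (n ∷ m ∷ ns) (there p)   (_ , adj) = adjK-coordinate (m ∷ ns) p adj

Fin2-≢-≢ : {x y z : Fin 2} → x ≢ y → y ≢ z → x ≡ z
Fin2-≢-≢ {zero}     {zero}     x≢y _   = contradiction refl x≢y
Fin2-≢-≢ {zero}     {suc zero} {zero}     _ _   = refl
Fin2-≢-≢ {_}        {suc zero} {suc zero} _ y≢z = contradiction refl y≢z
Fin2-≢-≢ {suc zero} {zero}     {suc zero} _ _   = refl
Fin2-≢-≢ {_}        {zero}     {zero}     _ y≢z = contradiction refl y≢z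
Fin2-≢-≢ {suc zero} {suc zero} x≢y _   = contradiction refl x≢y

-- Each step flips every coordinate in a factor K₂, so whether two such coordinates
-- agree is invariant along walks.
coordinates-agree : ∀ ns (p q : 2 ∈ ns) {u v} → Star (AdjK ns) u v →
  coordinate p u ≡ coordinate q u → coordinate p v ≡ coordinate q v
coordinates-agree ns p q ε eq = eq
coordinates-agree ns p q {u} (_◅_ {j = w} adj walk) eq = coordinates-agree ns p q walk
  (Fin2-≢-≢ {y = coordinate p u} (adjK-coordinate ns p adj ∘ sym)
    (subst (_≢ coordinate q w) (sym eq) (adjK-coordinate ns q adj)))

inhabited : ∀ {ns} → All (2 ≤_) ns → Tuple ns
inhabited []                         = tt
inhabited {suc _ ∷ _} (_ ∷ 2≤ns) = zero , inhabited 2≤ns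

-- From a vertex whose two K₂-coordinates agree, walks lead to `(y , xs)` for both values of `y`.
-- Invariance of agreement would make both values equal to the same coordinate of `xs`.
connected⇒2∉ : ∀ ns → Connected (KProd (2 ∷ ns)) → All (2 ≤_) ns → ¬ 2 ∈ ns
connected⇒2∉ ns connected 2≤ns p = Fin.0≢1+n (trans (agree zero) (sym (agree (suc zero))))
  where
  xs = inhabited 2≤ns
  agree : ∀ y → y ≡ coordinate p xs
  agree y = coordinates-agree (2 ∷ ns) (here refl) (there p)
    (connected (coordinate p xs , xs) (y , xs)) refl

-- Dropping the first coordinate maps edges to edges, so a walk between lifts with first coordinate
-- 0 projects to the required one.
connected-tail : ∀ n m ns → 2 ≤ n → Connected (KProd (n ∷ m ∷ ns)) → Connected (KProd (m ∷ ns))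
connected-tail (suc n) m ns _ connected xs ys = gmap proj₂ proj₂ (connected (zero , xs) (zero , ys))

-- In `oneK₂` the degree is that of the remaining factors, as `pred 2` is 1, while the order
-- doubles. The membership proof is kept so that a second K₂ can be refuted.
data Factors (ns : List ℕ) : Set where
  noK₂  : OrderDegree (product ns) (product (map pred ns)) → Factors ns
  oneK₂ : ∀ {n} → 2 ∈ ns → product ns ≡ 2 * n → OrderDegree n (product (map pred ns)) → Factors ns

factors : ∀ ns → Connected (KProd ns) → All (2 ≤_) ns → Factors ns
factors []       connected [] = noK₂ empty
factors (n ∷ ns) connected (2≤n ∷ 2≤ns) = extend (m≤n⇒m<n∨m≡n 2≤n) (tail ns connected 2≤ns)
  where
  tail : ∀ ns → Connected (KProd (n ∷ ns)) → All (2 ≤_) ns → Factors ns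
  tail []       _         _    = noK₂ empty
  tail (m ∷ ns) connected 2≤ns = factors (m ∷ ns) (connected-tail n m ns 2≤n connected) 2≤ns
  extend : 3 ≤ n ⊎ 2 ≡ n → Factors ns → Factors (n ∷ ns)
  extend (inj₁ 3≤n)  (noK₂ od)        = noK₂ (orderDegree-* n 3≤n od)
  extend (inj₁ 3≤n)  (oneK₂ {n′} p eq od) =
    oneK₂ (there p) (trans (cong (n *_) eq) (x∙yz≈y∙xz n 2 n′)) (orderDegree-* n 3≤n od)
  extend (inj₂ refl) (noK₂ od)        =
    oneK₂ (here refl) refl (subst (OrderDegree (product ns)) (sym (*-identityˡ _)) od)
  extend (inj₂ refl) (oneK₂ p _ _)    = contradiction p (connected⇒2∉ ns connected 2≤ns)

theorem5p5 : (ns : List ℕ) → 1 ≤ length ns → All (λ n → 0 < n) ns →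
    Connected (KProd ns) → DomPolyUnimodal (KProd ns)
theorem5p5 (n ∷ ns) _ _ connected =
  unimodal-of-balanced (KProd (n ∷ ns)) d (≤-reflexive ∘ sym ∘ degree-KProd n ns)
    (subst (λ N → Balanced N d) (sym (length-allTuples (n ∷ ns)))
      -- Order at most 1 is treated apart: a factor K₁ makes `d` zero, whereas `OrderDegree` assigns
      -- degree 1 to the empty product.
      ([ balanced-≤1 _ d , balanced-factors ∘ factors (n ∷ ns) connected ]′
        (connected⇒2≤ (n ∷ ns) connected)))
  where
  d = product (map pred (n ∷ ns))
  balanced-factors : Factors (n ∷ ns) → Balanced (product (n ∷ ns)) d
  balanced-factors (noK₂ od)       = balanced-product od
  balanced-factors (oneK₂ _ eq od) = subst (λ N → Balanced N d) (sym eq) (balanced-K₂× od)
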